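{- Let $w_1,w_2,w_3$ be any positive integers. Then for every integer $n\ge 0$ and all $y_1,y_2,y_3\in\mathbb{Z}_p$, the following six expressions are equal: \begin{align*} &\sum_{k+l+m=n}\binom{n}{k,l,m}E_{k,\chi}(w_1y_1)E_{l,\chi}(w_2y_2)E_{m,\chi}(w_3y_3)\,w_{1}^{l+m}w_{2}^{k+m}w_{3}^{k+l}\\ =&\sum_{k+l+m=n}\binom{n}{k,l,m}E_{k,\chi}(w_1y_1)E_{l,\chi}(w_3y_2)E_{m,\chi}(w_2y_3)\,w_{1}^{l+m}w_{3}^{k+m}w_{2}^{k+l}\\ =&\sum_{k+l+m=n}\binom{n}{k,l,m}E_{k,\chi}(w_2y_1)E_{l,\chi}(w_1y_2)E_{m,\chi}(w_3y_3)\,w_{2}^{l+m}w_{1}^{k+m}w_{3}^{k+l}\\ =&\sum_{k+l+m=n}\binom{n}{k,l,m}E_{k,\chi}(w_2y_1)E_{l,\chi}(w_3y_2)E_{m,\chi}(w_1y_3)\,w_{2}^{l+m}w_{3}^{k+m}w_{1}^{k+l}\\ =&\sum_{k+l+m=n}\binom{n}{k,l,m}E_{k,\chi}(w_3y_1)E_{l,\chi}(w_1y_2)E_{m,\chi}(w_2y_3)\,w_{3}^{l+m}w_{1}^{k+m}w_{2}^{k+l}\\ =&\sum_{k+l+m=n}\binom{n}{k,l,m}E_{k,\chi}(w_3y_1)E_{l,\chi}(w_2y_2)E_{m,\chi}(w_1y_3)\,w_{3}^{l+m}w_{2}^{k+m}w_{1}^{k+l}. \end{align*} Here each sum is over all nonnegative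 integers $k,l,m$ with $k+l+m=n$.
   Context: $p$ is a fixed odd prime, $\mathbb{Z}_p$ is the ring of $p$-adic integers, and $\mathbb{C}_p$ is the completion of an algebraic closure of $\mathbb{Q}_p$. $d$ is a fixed odd positive integer and $\chi$ is a (primitive) Dirichlet character of conductor $d$, with values in $\overline{\mathbb{Q}}$, regarded as $\mathbb{C}_p$-valued through a fixed embedding $\overline{\mathbb{Q}}\to\mathbb{C}_p$; as usual $\chi(a)=0$ when $\gcd(a,d)>1$ (and $\chi\equiv 1$ if $d=1$). The generalized Euler polynomials $E_{n,\chi}(x)$ attached to $\chi$ are the polynomials in $x$ defined by $$\frac{2e^{xt}}{e^{dt}+1}\sum_{a=0}^{d-1}(-1)^a\chi(a)e^{at}=\sum_{n=0}^{\infty}E_{n,\chi}(x)\frac{t^n}{n!}.$$ The multinomial coefficient is $\binom{n}{k,l,m}=\frac{n!}{k!\,l!\,m!}$. -}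

module Defs where

open import Level using (Level; _⊔_) renaming (suc to lsuc)
open import Algebra.Bundles using (CommutativeRing; RawRing)
open import Algebra.Apartness.Bundles using (HeytingField; HeytingCommutativeRing)
import Algebra.Definitions.RawSemiring as RawSemiringDefs
open import Algebra.Morphism.Structures using (module RingMorphisms)
open import Data.Fin.Base using (Fin; toℕ)
open import Data.Integer.Base as ℤ using (ℤ; +_)
import Data.Integer.Coprimality as ℤ
import Data.Integer.Divisibility as ℤ
open import Data.List.Base using (List; []; _∷_; map)
open import Data.Nat.Base as ℕ using (ℕ; zero; suc; _∸_; _!)
open import Data.Nat.Divisibility as ℕ using ()
open import Data.Nat.Properties using (_!≢0; _!*_!≢0; m*n≢0)
open import Data.Product.Base using (Σ-syntax; ∃-syntax; _,_)
open import Data.Rational.Base as ℚ using (ℚ; 1ℚ; 0ℚ; ½)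
import Data.Rational.Properties as ℚ
open import Relation.Binary.PropositionalEquality.Core using (_≡_)
open import Relation.Nullary.Negation.Core using (¬_)

private
  variable
    c ℓ₁ ℓ₂ c′ ℓ₁′ ℓ₂′ : Level

fieldRawRing : HeytingField c ℓ₁ ℓ₂ → RawRing c ℓ₁
fieldRawRing F =
  CommutativeRing.rawRing
    (HeytingCommutativeRing.commutativeRing (HeytingField.heytingCommutativeRing F))

⌞_⌟ : HeytingField c ℓ₁ ℓ₂ → Set c
⌞ F ⌟ = HeytingField.Carrier F

IsFieldHomomorphism : (F : HeytingField c ℓ₁ ℓ₂) (L : HeytingField c′ ℓ₁′ ℓ₂′) →
                      (⌞ F ⌟ → ⌞ L ⌟) → Set (c ⊔ ℓ₁ ⊔ ℓ₁′)
IsFieldHomomorphism F L = RingMorphisms.IsRingHomomorphism (fieldRawRing F) (fieldRawRing L)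

module _ (F : HeytingField c ℓ₁ ℓ₂) where
  open HeytingField F

  -- The list a₀ ∷ … ∷ aₙ₋₁ ∷ [] stands for the monic polynomial
  -- a₀ + a₁ x + … + aₙ₋₁ xⁿ⁻¹ + xⁿ of degree n.
  evalMonic : List Carrier → Carrier → Carrier
  evalMonic []       x = 1#
  evalMonic (a ∷ as) x = a + x * evalMonic as x

record AlgebraicClosure (F : HeytingField c ℓ₁ ℓ₂) (c′ ℓ₁′ ℓ₂′ : Level)
       : Set (c ⊔ ℓ₁ ⊔ lsuc (c′ ⊔ ℓ₁′ ⊔ ℓ₂′)) where
  field
    closure : HeytingField c′ ℓ₁′ ℓ₂′

  open HeytingField closure

  field
    ι                   : ⌞ F ⌟ → Carrier
    ι-homo              : IsFieldHomomorphism F closure ι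
    algebraic           : ∀ x → ∃[ as ] evalMonic closure (map ι as) x ≈ 0#
    algebraicallyClosed : ∀ a as → ∃[ x ] evalMonic closure (a ∷ as) x ≈ 0#

-- The absolute value is recorded additively, ∣x∣ = p^(-ν x) for x # 0.  The
-- value group of every field below is contained in ℚ.
record Valuation (F : HeytingField c ℓ₁ ℓ₂) : Set (c ⊔ ℓ₁ ⊔ ℓ₂) where
  open HeytingField F

  field
    ν : ∀ x → x # 0# → ℚ

  -- ν x ≥ q, under the convention ν 0 = ∞.
  infix 4 _≽_
  _≽_ : Carrier → ℚ → Set ℓ₂
  x ≽ q = ∀ (x#0 : x # 0#) → q ℚ.≤ ν x x#0

  field
    ν-cong : ∀ {x y} → x ≈ y → (x#0 : x # 0#) (y#0 : y # 0#) → ν x x#0 ≡ ν y y#0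
    ν-*    : ∀ {x y} (x#0 : x # 0#) (y#0 : y # 0#) (xy#0 : x * y # 0#) →
             ν (x * y) xy#0 ≡ ν x x#0 ℚ.+ ν y y#0
    ν-+    : ∀ {x y} q → x ≽ q → y ≽ q → x + y ≽ q

  Cauchy : (ℕ → Carrier) → Set ℓ₂
  Cauchy s = ∀ q → ∃[ N ] (∀ m n → N ℕ.≤ m → N ℕ.≤ n → s m - s n ≽ q)

  _ConvergesTo_ : (ℕ → Carrier) → Carrier → Set ℓ₂
  s ConvergesTo l = ∀ q → ∃[ N ] (∀ n → N ℕ.≤ n → s n - l ≽ q)

module _ {F : HeytingField c ℓ₁ ℓ₂} {L : HeytingField c′ ℓ₁′ ℓ₂′} where
  private
    module F = HeytingField F
    module L = HeytingField L

  Extends : Valuation F → Valuation L → (F.Carrier → L.Carrier) → Set (c ⊔ ℓ₂ ⊔ ℓ₂′)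
  Extends v w φ = ∀ {x} (x#0 : x F.# F.0#) (φx#0 : φ x L.# L.0#) →
                  Valuation.ν w (φ x) φx#0 ≡ Valuation.ν v x x#0

record Completion {F : HeytingField c ℓ₁ ℓ₂} (v : Valuation F) (c′ ℓ₁′ ℓ₂′ : Level)
       : Set (c ⊔ ℓ₁ ⊔ ℓ₂ ⊔ lsuc (c′ ⊔ ℓ₁′ ⊔ ℓ₂′)) where
  field
    completion : HeytingField c′ ℓ₁′ ℓ₂′
    valuation  : Valuation completion

  open HeytingField completion
  open Valuation valuation

  field
    ι        : ⌞ F ⌟ → Carrier
    ι-homo   : IsFieldHomomorphism F completion ι
    extends  : Extends v valuation ι
    dense    : ∀ x q → ∃[ a ] x - ι a ≽ q
    complete : ∀ s → Cauchy s → ∃[ l ] s ConvergesTo l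

-- Every nonzero rational is p^k * (a / b) with a, b prime to p, so these two
-- clauses and ν-* leave no freedom in ν.
record IsPadicValuation (p : ℕ) (v : Valuation ℚ.heytingField) : Set where
  open Valuation v
  field
    ν-p     : ∀ p≢0 → ν (+ p ℚ./ 1) p≢0 ≡ 1ℚ
    ν-units : ∀ a a≢0 → ¬ (+ p ℤ.∣ a) → ν (a ℚ./ 1) a≢0 ≡ 0ℚ

record PadicFields (p : ℕ) (c ℓ₁ ℓ₂ : Level) : Set (lsuc (c ⊔ ℓ₁ ⊔ ℓ₂)) where
  field
    νₚ      : Valuation ℚ.heytingField
    νₚ-adic : IsPadicValuation p νₚ
    ℚₚ-data : Completion νₚ c ℓ₁ ℓ₂

  module ℚₚ = Completion ℚₚ-data

  field
    ℚₚᵃ-data : AlgebraicClosure ℚₚ.completion c ℓ₁ ℓ₂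

  module ℚₚᵃ = AlgebraicClosure ℚₚᵃ-data

  field
    νᵃ         : Valuation ℚₚᵃ.closure
    νᵃ-extends : Extends ℚₚ.valuation νᵃ ℚₚᵃ.ι
    ℂₚ-data    : Completion νᵃ c ℓ₁ ℓ₂

  module ℂₚ = Completion ℂₚ-data

  ℂₚ : HeytingField c ℓ₁ ℓ₂
  ℂₚ = ℂₚ.completion

  ℤₚ : Set (c ⊔ ℓ₂)
  ℤₚ = Σ[ y ∈ ⌞ ℚₚ.completion ⌟ ] Valuation._≽_ ℚₚ.valuation y 0ℚ

  ℚₚ→ℂₚ : ⌞ ℚₚ.completion ⌟ → ⌞ ℂₚ ⌟
  ℚₚ→ℂₚ y = ℂₚ.ι (ℚₚᵃ.ι y)

  ℤₚ→ℂₚ : ℤₚ → ⌞ ℂₚ ⌟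
  ℤₚ→ℂₚ (y , _) = ℚₚ→ℂₚ y

  ℚ→ℂₚ : ℚ → ⌞ ℂₚ ⌟
  ℚ→ℂₚ r = ℚₚ→ℂₚ (ℚₚ.ι r)

record DirichletCharacter (F : HeytingField c ℓ₁ ℓ₂) (d : ℕ) : Set (c ⊔ ℓ₁ ⊔ ℓ₂) where
  open HeytingField F
  field
    χ           : ℤ → Carrier
    χ-periodic  : ∀ a b → + d ℤ.∣ a ℤ.- b → χ a ≈ χ b
    χ-1         : χ (+ 1) ≈ 1#
    χ-*         : ∀ a b → χ (a ℤ.* b) ≈ χ a * χ b
    χ-coprime   : ∀ a → ℤ.Coprime a (+ d) → χ a # 0#
    χ-noncoprime : ∀ a → ¬ ℤ.Coprime a (+ d) → χ a ≈ 0#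

  -- χ has conductor d: it is not induced from any proper divisor e of d.
  IsPrimitive : Set ℓ₁
  IsPrimitive = ∀ e → e ℕ.∣ d →
                (∀ a → ℤ.Coprime a (+ d) → + e ℤ.∣ a ℤ.- + 1 → χ a ≈ 1#) →
                e ≡ d

module Polynomials (K : HeytingField c ℓ₁ ℓ₂) where
  open HeytingField K

  -- Coefficient lists, constant term first.
  Poly : Set c
  Poly = List Carrier

  coeff : Poly → ℕ → Carrier
  coeff []      _       = 0#
  coeff (a ∷ f) zero    = a
  coeff (a ∷ f) (suc n) = coeff f n

  infixl 6 _+ₚ_
  _+ₚ_ : Poly → Poly → Poly
  []      +ₚ g       = g
  (a ∷ f) +ₚ []      = a ∷ f
  (a ∷ f) +ₚ (b ∷ g) = (a + b) ∷ (f +ₚ g)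

  infixl 7 _*ₚ_
  _*ₚ_ : Poly → Poly → Poly
  []      *ₚ g = []
  (a ∷ f) *ₚ g = map (a *_) g +ₚ (0# ∷ (f *ₚ g))

  const : Carrier → Poly
  const a = a ∷ []

  X : Poly
  X = 0# ∷ 1# ∷ []

  -- Lists differing by trailing zeros are the same polynomial.
  polyRawRing : RawRing c ℓ₁
  polyRawRing = record
    { Carrier = Poly
    ; _≈_     = λ f g → ∀ n → coeff f n ≈ coeff g n
    ; _+_     = _+ₚ_
    ; _*_     = _*ₚ_
    ; -_      = map (λ a → - a)
    ; 0#      = []
    ; 1#      = const 1#
    }

  eval : Poly → Carrier → Carrier
  eval []      x = 0#
  eval (a ∷ f) x = a + x * eval f x

1/_! : ℕ → ℚ
1/ n ! = ℚ._/_ (+ 1) (n !) {{n !≢0}}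

module PowerSeries (R : RawRing c ℓ₁) (fromℚ : ℚ → RawRing.Carrier R) where
  open RawRing R
  open RawSemiringDefs rawSemiring using (sum; _^_)

  -- f stands for Σₙ (f n) tⁿ.
  Series : Set c
  Series = ℕ → Carrier

  infixl 6 _⊕_
  _⊕_ : Series → Series → Series
  (f ⊕ g) n = f n + g n

  infixl 7 _⊛_
  _⊛_ : Series → Series → Series
  (f ⊛ g) n = sum {suc n} (λ i → f (toℕ i) * g (n ∸ toℕ i))

  infixr 7 _•_
  _•_ : Carrier → Series → Series
  (a • f) n = a * f n

  one : Series
  one zero    = 1#
  one (suc n) = 0#

  -- f / g by long division, given an inverse u of the constant term of g:
  -- writing f = f₀ + t f′ and g = g₀ + t g′,  f/g = q₀ + t (f′ - q₀ g′)/g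
  -- with q₀ = f₀ u.
  quotient : Carrier → Series → Series → Series
  quotient u f g zero    = f 0 * u
  quotient u f g (suc n) =
    quotient u (λ k → f (suc k) + - (f 0 * u * g (suc k))) g n

  -- The series e^(at).
  exp : Carrier → Series
  exp a n = fromℚ (1/ n !) * a ^ n

module GeneralizedEuler (K : HeytingField c ℓ₁ ℓ₂) (fromℚ : ℚ → HeytingField.Carrier K)
                        (d : ℕ) (χ : ℤ → HeytingField.Carrier K) where
  open Polynomials K public
  open PowerSeries polyRawRing (λ r → const (fromℚ r))
  open RawRing polyRawRing
  open RawSemiringDefs rawSemiring using (sum; _×_; _^_)

  -- Σ_{a < d} (-1)^a χ(a) e^(at)
  characterSum : Series
  characterSum n =
    sum {d} (λ i → let a = toℕ i in
                   (((- 1#) ^ a * const (χ (+ a))) • exp (a × 1#)) n)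

  -- The constant term of e^(dt) + 1 is 2.
  generatingFunction : Series
  generatingFunction =
    quotient (const (fromℚ ½)) ((2 × 1#) • exp X) (exp (d × 1#) ⊕ one) ⊛ characterSum

  E : ℕ → Poly
  E n = (n !) × generatingFunction n

multinomial : ℕ → ℕ → ℕ → ℕ
multinomial k l m = ℕ._/_ ((k ℕ.+ l ℕ.+ m) !) (k ! ℕ.* l ! ℕ.* m !)
                          {{m*n≢0 _ _ {{k !* l !≢0}} {{m !≢0}}}}

module EulerSum (K : HeytingField c ℓ₁ ℓ₂) (fromℚ : ℚ → HeytingField.Carrier K)
                (d : ℕ) (χ : ℤ → HeytingField.Carrier K) where
  open HeytingField K using (Carrier; _*_)
  open RawSemiringDefs (RawRing.rawSemiring (fieldRawRing K)) using (sum; _×_)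
  open GeneralizedEuler K fromℚ d χ using (E; eval)

  sumOverTriples : ℕ → (ℕ → ℕ → ℕ → Carrier) → Carrier
  sumOverTriples n f =
    sum {suc n} (λ i → sum {suc (n ∸ toℕ i)} (λ j → f (toℕ i) (toℕ j) (n ∸ toℕ i ∸ toℕ j)))

  eulerSum : ℕ → (u v w : ℕ) → (y₁ y₂ y₃ : Carrier) → Carrier
  eulerSum n u v w y₁ y₂ y₃ =
    sumOverTriples n λ k l m →
      (multinomial k l m ℕ.* u ℕ.^ (l ℕ.+ m) ℕ.* v ℕ.^ (k ℕ.+ m) ℕ.* w ℕ.^ (k ℕ.+ l)) ×
        (eval (E k) (u × y₁) * eval (E l) (v × y₂) * eval (E m) (w × y₃))

{-# OPTIONS --safe #-}
-- Evaluated at x, the generating function of the polynomials E_{n,χ} is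
-- F(t; x) = e^(xt) G(t) with G independent of x.  The sum with parameters
-- (u, v, w) is n! times the coefficient of tⁿ in
--   F(vwt; uy₁) F(uwt; vy₂) F(uvt; wy₃)
--     = e^(uvwy₁t) e^(uvwy₂t) e^(uvwy₃t) G(vwt) G(uwt) G(uvt),
-- which is symmetric in u, v, w.
module Submission where

open import Defs
open import Algebra.Apartness.Bundles using (HeytingField; HeytingCommutativeRing)
open import Algebra.Bundles using (CommutativeRing; CommutativeSemigroup; RawRing)
import Algebra.Definitions.RawSemiring as RawSemiringDefs
import Algebra.Properties.CommutativeMonoid.Mult as CommutativeMonoidMult
import Algebra.Properties.CommutativeSemigroup as CommutativeSemigroupProperties
import Algebra.Properties.CommutativeSemiring.Exp as Exp
import Algebra.Properties.Ring as RingProperties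
import Algebra.Properties.Semiring.Mult as Mult
import Algebra.Properties.Semiring.Sum as Sum
open import Data.Fin.Base using (Fin; zero; suc; toℕ)
open import Data.Fin.Properties using (toℕ≤pred[n])
open import Data.Integer.Base using (ℤ; +_)
open import Data.List.Base using ([]; _∷_; map)
open import Data.Nat.Base as ℕ using (ℕ; zero; suc; NonZero; _∸_; _!; _≤_)
open import Data.Nat.Combinatorics using (k![n∸k]!∣n!)
open import Data.Nat.Divisibility using (_∣_; ∣-trans; *-monoˡ-∣)
open import Data.Nat.DivMod using (m/n*n≡m)
open import Data.Nat.Primality using (Prime)
import Data.Nat.Properties as ℕ
open import Data.Nat.Solver using (module +-*-Solver)
open import Data.Product.Base using (_×_; _,_)
open import Data.Rational.Base using (ℚ; ½)
open import Data.Rational.Properties using (heytingField)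
open import Relation.Binary.PropositionalEquality as ≡ using (_≡_)
import Relation.Binary.Reasoning.Setoid as SetoidReasoning
open import Relation.Nullary.Negation.Core using (¬_)

-- Multinomial coefficients and the weights of the triple sum.

k!*l!∣[k+l]! : ∀ k l → k ! ℕ.* l ! ∣ (k ℕ.+ l) !
k!*l!∣[k+l]! k l = ≡.subst (λ j → k ! ℕ.* j ! ∣ (k ℕ.+ l) !) (ℕ.m+n∸m≡n k l)
                     (k![n∸k]!∣n! (ℕ.m≤m+n k l))

-- `multinomial` is defined by truncating division, so its exactness has to be shown. Two binomial
-- divisibilities are chained: `k ! * l !` divides `(k + l) !`, and `(k + l) ! * m !` divides
-- `(k + l + m) !`.
multinomial*k!*l!*m!≡[k+l+m]! : ∀ k l m →
  multinomial k l m ℕ.* (k ! ℕ.* l ! ℕ.* m !) ≡ (k ℕ.+ l ℕ.+ m) !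
multinomial*k!*l!*m!≡[k+l+m]! k l m =
  m/n*n≡m {{ℕ.m*n≢0 _ _ {{k ℕ.!* l !≢0}} {{m ℕ.!≢0}}}}
    (∣-trans (*-monoˡ-∣ (m !) (k!*l!∣[k+l]! k l)) (k!*l!∣[k+l]! (k ℕ.+ l) m))

-- The third index in `sumOverTriples` is a truncated difference; the bounds on `i` and `j` make it
-- a genuine one.
i+j+[n∸i∸j]≡n : ∀ {i j n} → i ≤ n → j ≤ n ∸ i → i ℕ.+ j ℕ.+ (n ∸ i ∸ j) ≡ n
i+j+[n∸i∸j]≡n {i} {j} {n} i≤n j≤n∸i = begin
  i ℕ.+ j ℕ.+ (n ∸ i ∸ j)    ≡⟨ ℕ.+-assoc i j _ ⟩
  i ℕ.+ (j ℕ.+ (n ∸ i ∸ j))  ≡⟨ ≡.cong (i ℕ.+_) (ℕ.m+[n∸m]≡n j≤n∸i) ⟩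
  i ℕ.+ (n ∸ i)              ≡⟨ ℕ.m+[n∸m]≡n i≤n ⟩
  n                          ∎
  where open ≡.≡-Reasoning

^-distribʳ-* : ∀ m n k → (m ℕ.* n) ℕ.^ k ≡ m ℕ.^ k ℕ.* n ℕ.^ k
^-distribʳ-* m n zero    = ≡.refl
^-distribʳ-* m n (suc k) = ≡.trans (≡.cong (m ℕ.* n ℕ.*_) (^-distribʳ-* m n k))
  (ℕ.[m*n]*[o*p]≡[m*o]*[n*p] m n (m ℕ.^ k) (n ℕ.^ k))

-- The powers are regrouped by index instead of by base: `k` is an exponent of `v` and `w` only, `l`
-- of `u` and `w`, `m` of `u` and `v`. Each index thus carries the weight of a substitution for t,
-- namely vwt, uwt or uvt. The product of factorials on the left is the one that the three Euler
-- polynomials contribute.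
multinomial-weight : ∀ u v w k l m →
  multinomial k l m ℕ.* u ℕ.^ (l ℕ.+ m) ℕ.* v ℕ.^ (k ℕ.+ m) ℕ.* w ℕ.^ (k ℕ.+ l)
    ℕ.* (k ! ℕ.* l ! ℕ.* m !)
  ≡ (k ℕ.+ l ℕ.+ m) ! ℕ.*
    ((v ℕ.* w) ℕ.^ k ℕ.* ((u ℕ.* w) ℕ.^ l ℕ.* (u ℕ.* v) ℕ.^ m))
multinomial-weight u v w k l m = begin
  M ℕ.* u ℕ.^ (l ℕ.+ m) ℕ.* v ℕ.^ (k ℕ.+ m) ℕ.* w ℕ.^ (k ℕ.+ l) ℕ.* D
    ≡⟨ ≡.cong₂ (λ a b → M ℕ.* a ℕ.* b ℕ.* w ℕ.^ (k ℕ.+ l) ℕ.* D)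
         (ℕ.^-distribˡ-+-* u l m) (ℕ.^-distribˡ-+-* v k m) ⟩
  M ℕ.* (u ℕ.^ l ℕ.* u ℕ.^ m) ℕ.* (v ℕ.^ k ℕ.* v ℕ.^ m) ℕ.* w ℕ.^ (k ℕ.+ l) ℕ.* D
    ≡⟨ ≡.cong (λ a → M ℕ.* (u ℕ.^ l ℕ.* u ℕ.^ m) ℕ.* (v ℕ.^ k ℕ.* v ℕ.^ m) ℕ.* a ℕ.* D)
         (ℕ.^-distribˡ-+-* w k l) ⟩
  M ℕ.* (u ℕ.^ l ℕ.* u ℕ.^ m) ℕ.* (v ℕ.^ k ℕ.* v ℕ.^ m) ℕ.* (w ℕ.^ k ℕ.* w ℕ.^ l) ℕ.* D
    ≡⟨ solve 8 (λ M D ul um vk vm wk wl →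
         M :* (ul :* um) :* (vk :* vm) :* (wk :* wl) :* D :=
         M :* D :* ((vk :* wk) :* ((ul :* wl) :* (um :* vm))))
         ≡.refl M D (u ℕ.^ l) (u ℕ.^ m) (v ℕ.^ k) (v ℕ.^ m) (w ℕ.^ k) (w ℕ.^ l) ⟩
  M ℕ.* D ℕ.* ((v ℕ.^ k ℕ.* w ℕ.^ k) ℕ.* ((u ℕ.^ l ℕ.* w ℕ.^ l) ℕ.* (u ℕ.^ m ℕ.* v ℕ.^ m)))
    ≡⟨ ≡.cong₂ ℕ._*_ (multinomial*k!*l!*m!≡[k+l+m]! k l m)
         (≡.cong₂ ℕ._*_ (≡.sym (^-distribʳ-* v w k))
           (≡.cong₂ ℕ._*_ (≡.sym (^-distribʳ-* u w l)) (≡.sym (^-distribʳ-* u v m)))) ⟩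
  (k ℕ.+ l ℕ.+ m) ! ℕ.* ((v ℕ.* w) ℕ.^ k ℕ.* ((u ℕ.* w) ℕ.^ l ℕ.* (u ℕ.* v) ℕ.^ m)) ∎
  where
  open ≡.≡-Reasoning
  open +-*-Solver
  M = multinomial k l m
  D = k ! ℕ.* l ! ℕ.* m !

-- Formal power series over a commutative ring.

module PowerSeriesProperties {c ℓ} (R : CommutativeRing c ℓ)
                             (fromℚ : ℚ → CommutativeRing.Carrier R) where
  open CommutativeRing R hiding (zero)
  open PowerSeries rawRing fromℚ
  open Mult semiring renaming (_×_ to infixr 8 _·_)
  open CommutativeMonoidMult +-commutativeMonoid using (×-distrib-+)
  open Exp commutativeSemiring using (_^_; ^-congˡ)
  open Sum semiring using (sum; sum-cong-≋; ∑-distrib-+; *-distribˡ-sum)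
  open CommutativeSemigroupProperties +-commutativeSemigroup using (interchange)
  open RingProperties ring using (-‿distribʳ-*; -‿+-comm)
  open SetoidReasoning setoid

  private
    variable
      f f′ g g′ : Series

  infix 4 _≋_
  _≋_ : Series → Series → Set ℓ
  f ≋ g = ∀ n → f n ≈ g n

  -- This is (f - f₀)/t. Since `sum` unfolds at its first term, `(f ⊛ g) (suc n)` is by definition
  -- `f 0 * g (suc n) + (tail f ⊛ g) n`; the inductions on the coefficient below rely on this.
  tail : Series → Series
  tail f n = f (suc n)

  ⊛-cong : f ≋ f′ → g ≋ g′ → f ⊛ g ≋ f′ ⊛ g′
  ⊛-cong f≋f′ g≋g′ n =
    sum-cong-≋ {suc n} λ i → *-cong (f≋f′ (toℕ i)) (g≋g′ (n ∸ toℕ i))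

  ⊛-congˡ : ∀ f → g ≋ g′ → f ⊛ g ≋ f ⊛ g′
  ⊛-congˡ f = ⊛-cong {f} λ _ → refl

  ⊛-congʳ : ∀ g → f ≋ f′ → f ⊛ g ≋ f′ ⊛ g
  ⊛-congʳ g f≋f′ = ⊛-cong {g = g} f≋f′ λ _ → refl

  ⊛-distribʳ : ∀ h f g → (f ⊕ g) ⊛ h ≋ f ⊛ h ⊕ g ⊛ h
  ⊛-distribʳ h f g n = trans
    (sum-cong-≋ {suc n} λ i → distribʳ (h (n ∸ toℕ i)) (f (toℕ i)) (g (toℕ i)))
    (∑-distrib-+ {suc n} (λ i → f (toℕ i) * h (n ∸ toℕ i)) (λ i → g (toℕ i) * h (n ∸ toℕ i)))

  •-⊛-assoc : ∀ a f g → (a • f) ⊛ g ≋ a • (f ⊛ g)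
  •-⊛-assoc a f g n = trans
    (sum-cong-≋ {suc n} λ i → *-assoc a (f (toℕ i)) (g (n ∸ toℕ i)))
    (sym (*-distribˡ-sum {suc n} a (λ i → f (toℕ i) * g (n ∸ toℕ i))))

  ⊛-assoc : ∀ f g h → (f ⊛ g) ⊛ h ≋ f ⊛ (g ⊛ h)
  ⊛-assoc f g h zero = +-congʳ (begin
    (f 0 * g 0 + 0#) * h 0    ≈⟨ *-congʳ (+-identityʳ _) ⟩
    f 0 * g 0 * h 0           ≈⟨ *-assoc _ _ _ ⟩
    f 0 * (g 0 * h 0)         ≈⟨ *-congˡ (+-identityʳ _) ⟨
    f 0 * (g 0 * h 0 + 0#)    ∎)
  ⊛-assoc f g h (suc n) = begin
    -- The tail of `f ⊛ g` is by definition `f 0 • tail g ⊕ tail f ⊛ g`, so distributivity reduces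
    -- the claim to the induction hypothesis for `tail f`.
    (f 0 * g 0 + 0#) * h (suc n) + ((f 0 • tail g ⊕ tail f ⊛ g) ⊛ h) n
      ≈⟨ +-cong (*-congʳ (+-identityʳ _)) (⊛-distribʳ h (f 0 • tail g) (tail f ⊛ g) n) ⟩
    f 0 * g 0 * h (suc n) + (((f 0 • tail g) ⊛ h) n + ((tail f ⊛ g) ⊛ h) n)
      ≈⟨ +-cong (*-assoc _ _ _) (+-cong (•-⊛-assoc (f 0) (tail g) h n) (⊛-assoc (tail f) g h n)) ⟩
    f 0 * (g 0 * h (suc n)) + (f 0 * (tail g ⊛ h) n + (tail f ⊛ (g ⊛ h)) n)
      ≈⟨ +-assoc _ _ _ ⟨
    f 0 * (g 0 * h (suc n)) + f 0 * (tail g ⊛ h) n + (tail f ⊛ (g ⊛ h)) n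
      ≈⟨ +-congʳ (distribˡ _ _ _) ⟨
    f 0 * (g 0 * h (suc n) + (tail g ⊛ h) n) + (tail f ⊛ (g ⊛ h)) n ∎

  -- The definition of `_⊛_` peels off the constant term of the left factor. Commutativity also
  -- needs the mirror image, where the constant term of the right factor, found in the last summand,
  -- is split off.
  ⊛-suc : ∀ f g n → (f ⊛ g) (suc n) ≈ f (suc n) * g 0 + (f ⊛ tail g) n
  ⊛-suc f g zero = begin
    f 0 * g 1 + (f 1 * g 0 + 0#)  ≈⟨ +-congˡ (+-identityʳ _) ⟩
    f 0 * g 1 + f 1 * g 0         ≈⟨ +-comm _ _ ⟩
    f 1 * g 0 + f 0 * g 1         ≈⟨ +-congˡ (+-identityʳ _) ⟨
    f 1 * g 0 + (f 0 * g 1 + 0#)  ∎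
  ⊛-suc f g (suc n) = begin
    f 0 * g (2 ℕ.+ n) + (tail f ⊛ g) (suc n)
      ≈⟨ +-congˡ (⊛-suc (tail f) g n) ⟩
    f 0 * g (2 ℕ.+ n) + (f (2 ℕ.+ n) * g 0 + (tail f ⊛ tail g) n)
      ≈⟨ +-assoc _ _ _ ⟨
    f 0 * g (2 ℕ.+ n) + f (2 ℕ.+ n) * g 0 + (tail f ⊛ tail g) n
      ≈⟨ +-congʳ (+-comm _ _) ⟩
    f (2 ℕ.+ n) * g 0 + f 0 * g (2 ℕ.+ n) + (tail f ⊛ tail g) n
      ≈⟨ +-assoc _ _ _ ⟩
    f (2 ℕ.+ n) * g 0 + (f 0 * g (2 ℕ.+ n) + (tail f ⊛ tail g) n) ∎

  ⊛-comm : ∀ f g → f ⊛ g ≋ g ⊛ f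
  ⊛-comm f g zero    = +-congʳ (*-comm _ _)
  ⊛-comm f g (suc n) = begin
    f 0 * g (suc n) + (tail f ⊛ g) n  ≈⟨ +-cong (*-comm _ _) (⊛-comm (tail f) g n) ⟩
    g (suc n) * f 0 + (g ⊛ tail f) n  ≈⟨ ⊛-suc g f n ⟨
    (g ⊛ f) (suc n)                   ∎

  ⊛-commutativeSemigroup : CommutativeSemigroup c ℓ
  ⊛-commutativeSemigroup = record
    { Carrier = Series
    ; _≈_     = _≋_
    ; _∙_     = _⊛_
    ; isCommutativeSemigroup = record
      { isSemigroup = record
        { isMagma = record
          { isEquivalence = record
            { refl  = λ _ → refl
            ; sym   = λ f≋g n → sym (f≋g n)
            ; trans = λ f≋g g≋h n → trans (f≋g n) (g≋h n)
            }
          ; ∙-cong = ⊛-cong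
          }
        ; assoc = ⊛-assoc
        }
      ; comm = ⊛-comm
      }
    }

  -- Long division of power series.

  quotient-cong : ∀ {u u′} → u ≈ u′ → f ≋ f′ → g ≋ g′ →
                  quotient u f g ≋ quotient u′ f′ g′
  quotient-cong u≈u′ f≋f′ g≋g′ zero    = *-cong (f≋f′ 0) u≈u′
  quotient-cong u≈u′ f≋f′ g≋g′ (suc n) = quotient-cong u≈u′
    (λ k → +-cong (f≋f′ (suc k))
             (-‿cong (*-cong (*-cong (f≋f′ 0) u≈u′) (g≋g′ (suc k)))))
    g≋g′ n

  quotient-congˡ : ∀ {u} → f ≋ f′ → quotient u f g ≋ quotient u f′ g
  quotient-congˡ f≋f′ = quotient-cong refl f≋f′ λ _ → refl

  -- One division step leaves a remainder that is linear in the dividend. The induction on the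
  -- coefficient therefore keeps the dividends general and applies to the two remainders.
  quotient-⊕ : ∀ u f g h → quotient u (f ⊕ g) h ≋ quotient u f h ⊕ quotient u g h
  quotient-⊕ u f g h zero    = distribʳ _ _ _
  quotient-⊕ u f g h (suc n) = trans
    (quotient-congˡ remainder n)
    (quotient-⊕ u _ _ h n)
    where
    remainder : ∀ k →
      f (suc k) + g (suc k) - (f 0 + g 0) * u * h (suc k) ≈
      (f (suc k) - f 0 * u * h (suc k)) + (g (suc k) - g 0 * u * h (suc k))
    remainder k = begin
      f (suc k) + g (suc k) - (f 0 + g 0) * u * h (suc k)
        ≈⟨ +-congˡ (-‿cong (trans (*-congʳ (distribʳ _ _ _)) (distribʳ _ _ _))) ⟩
      f (suc k) + g (suc k) - (f 0 * u * h (suc k) + g 0 * u * h (suc k))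
        ≈⟨ +-congˡ (-‿+-comm _ _) ⟨
      f (suc k) + g (suc k) + (- (f 0 * u * h (suc k)) - g 0 * u * h (suc k))
        ≈⟨ interchange _ _ _ _ ⟩
      (f (suc k) - f 0 * u * h (suc k)) + (g (suc k) - g 0 * u * h (suc k)) ∎

  quotient-• : ∀ u a f g → quotient u (a • f) g ≋ a • quotient u f g
  quotient-• u a f g zero    = *-assoc _ _ _
  quotient-• u a f g (suc n) = trans
    (quotient-congˡ remainder n)
    (quotient-• u a _ g n)
    where
    remainder : ∀ k →
      a * f (suc k) - a * f 0 * u * g (suc k) ≈ a * (f (suc k) - f 0 * u * g (suc k))
    remainder k = begin
      a * f (suc k) - a * f 0 * u * g (suc k)
        ≈⟨ +-congˡ (-‿cong (trans (*-congʳ (*-assoc _ _ _)) (*-assoc _ _ _))) ⟩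
      a * f (suc k) - a * (f 0 * u * g (suc k))
        ≈⟨ +-congˡ (-‿distribʳ-* _ _) ⟩
      a * f (suc k) + a * - (f 0 * u * g (suc k))
        ≈⟨ distribˡ _ _ _ ⟨
      a * (f (suc k) - f 0 * u * g (suc k)) ∎

  -- Holds for every u, as both sides are linear in f and commute with
  -- multiplication by t.
  quotient≋⊛ : ∀ u f g → quotient u f g ≋ f ⊛ quotient u one g
  quotient≋⊛ u f g zero    = begin
    f 0 * u              ≈⟨ *-congˡ (*-identityˡ u) ⟨
    f 0 * (1# * u)       ≈⟨ +-identityʳ _ ⟨
    f 0 * (1# * u) + 0#  ∎
  quotient≋⊛ u f g (suc n) = begin
    quotient u (λ k → f (suc k) - f 0 * u * g (suc k)) g n
      ≈⟨ quotient-congˡ remainder n ⟩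
    quotient u (f 0 • r ⊕ tail f) g n
      ≈⟨ quotient-⊕ u (f 0 • r) (tail f) g n ⟩
    quotient u (f 0 • r) g n + quotient u (tail f) g n
      ≈⟨ +-cong (quotient-• u (f 0) r g n) (quotient≋⊛ u (tail f) g n) ⟩
    f 0 * quotient u r g n + (tail f ⊛ quotient u one g) n ∎
    where
    -- `r` is the remainder after one step of dividing `one` by `g`, so `quotient u r g n` is by
    -- definition coefficient `suc n` of `quotient u one g`. The remainder for `f` is `f 0 • r` plus
    -- the tail of `f`, which matches the unfolding of the product.
    r : Series
    r k = 0# - 1# * u * g (suc k)
    remainder : ∀ k → f (suc k) - f 0 * u * g (suc k) ≈ f 0 * r k + f (suc k)
    remainder k = begin
      f (suc k) - f 0 * u * g (suc k)          ≈⟨ +-comm _ _ ⟩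
      - (f 0 * u * g (suc k)) + f (suc k)      ≈⟨ +-congʳ (-‿cong (*-assoc _ _ _)) ⟩
      - (f 0 * (u * g (suc k))) + f (suc k)    ≈⟨ +-congʳ (-‿distribʳ-* _ _) ⟩
      f 0 * - (u * g (suc k)) + f (suc k)
        ≈⟨ +-congʳ (*-congˡ (-‿cong (*-congʳ (*-identityˡ u)))) ⟨
      f 0 * - (1# * u * g (suc k)) + f (suc k) ≈⟨ +-congʳ (*-congˡ (+-identityˡ _)) ⟨
      f 0 * r k + f (suc k)                    ∎

  -- The substitution of at for t, written `scale a`.

  scale : ℕ → Series → Series
  scale a f n = (a ℕ.^ n) · f n

  ·-*-· : ∀ m n x y → (m · x) * (n · y) ≈ (m ℕ.* n) · (x * y)
  ·-*-· m n x y = begin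
    (m · x) * (n · y)    ≈⟨ ×-assoc-* m x (n · y) ⟩
    m · (x * (n · y))    ≈⟨ ×-congʳ m (×-comm-* n x y) ⟩
    m · (n · (x * y))    ≈⟨ ×-assocˡ (x * y) m n ⟩
    (m ℕ.* n) · (x * y)  ∎

  ·-distrib-sum : ∀ m {n} (xs : Fin n → Carrier) → m · sum xs ≈ sum (λ i → m · xs i)
  ·-distrib-sum m {zero}  xs = begin
    -- Writing `0#` as `0# * 0#` lets the multiple move into one factor, where the other factor
    -- annihilates it.
    m · 0#         ≈⟨ ×-congʳ m (zeroˡ 0#) ⟨
    m · (0# * 0#)  ≈⟨ ×-comm-* m 0# 0# ⟨
    0# * (m · 0#)  ≈⟨ zeroˡ _ ⟩
    0#             ∎
  ·-distrib-sum m {suc n} xs =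
    trans (×-distrib-+ _ _ m) (+-congˡ (·-distrib-sum m (λ i → xs (suc i))))

  ^-distrib-· : ∀ a x n → (a · x) ^ n ≈ (a ℕ.^ n) · x ^ n
  ^-distrib-· a x zero    = sym (×-homo-1 1#)
  ^-distrib-· a x (suc n) = trans (*-congˡ (^-distrib-· a x n)) (·-*-· a (a ℕ.^ n) x _)

  -- On the term with index i the weight a^n splits as a^i times a^(n - i); the bound on elements of
  -- `Fin (suc n)` makes the truncated difference exact.
  scale-⊛ : ∀ a f g → scale a (f ⊛ g) ≋ scale a f ⊛ scale a g
  scale-⊛ a f g n = trans
    (·-distrib-sum (a ℕ.^ n) {suc n} (λ i → f (toℕ i) * g (n ∸ toℕ i)))
    (sum-cong-≋ {suc n} term)
    where
    term : ∀ (i : Fin (suc n)) → (a ℕ.^ n) · (f (toℕ i) * g (n ∸ toℕ i)) ≈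
                   scale a f (toℕ i) * scale a g (n ∸ toℕ i)
    term i = begin
      (a ℕ.^ n) · (f (toℕ i) * g (n ∸ toℕ i))
        ≈⟨ ×-congˡ (≡.trans (≡.cong (a ℕ.^_) (≡.sym (ℕ.m+[n∸m]≡n (toℕ≤pred[n] i))))
                            (ℕ.^-distribˡ-+-* a (toℕ i) (n ∸ toℕ i))) ⟩
      (a ℕ.^ toℕ i ℕ.* a ℕ.^ (n ∸ toℕ i)) · (f (toℕ i) * g (n ∸ toℕ i))
        ≈⟨ ·-*-· (a ℕ.^ toℕ i) (a ℕ.^ (n ∸ toℕ i)) _ _ ⟨
      scale a f (toℕ i) * scale a g (n ∸ toℕ i) ∎

  exp-cong : ∀ {x y} → x ≈ y → exp x ≋ exp y
  exp-cong x≈y n = *-congˡ (^-congˡ n x≈y)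

  scale-exp : ∀ a x → scale a (exp x) ≋ exp (a · x)
  scale-exp a x n = begin
    (a ℕ.^ n) · (fromℚ (1/ n !) * x ^ n)  ≈⟨ ×-comm-* (a ℕ.^ n) _ _ ⟨
    fromℚ (1/ n !) * (a ℕ.^ n) · x ^ n    ≈⟨ *-congˡ (^-distrib-· a x n) ⟨
    fromℚ (1/ n !) * (a · x) ^ n          ∎

-- Evaluation of polynomials at a fixed point.

fieldCommutativeRing : ∀ {c ℓ₁ ℓ₂} → HeytingField c ℓ₁ ℓ₂ → CommutativeRing c ℓ₁
fieldCommutativeRing K =
  HeytingCommutativeRing.commutativeRing (HeytingField.heytingCommutativeRing K)

-- `polyRawRing` carries operations but no laws. Showing that evaluation respects each operation
-- moves the computations with series of polynomials to series over `K`, where the ring laws hold.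
module Evaluation {c ℓ₁ ℓ₂} (K : HeytingField c ℓ₁ ℓ₂) (x : HeytingField.Carrier K) where
  open CommutativeRing (fieldCommutativeRing K) hiding (zero)
  open Polynomials K
  open RawSemiringDefs (RawRing.rawSemiring polyRawRing) using ()
    renaming (sum to sumₚ; _×_ to infixr 8 _·ₚ_; _^_ to infixr 8 _^ₚ_)
  open RawSemiringDefs (RawRing.rawSemiring rawRing) using (sum; _^_) renaming (_×_ to infixr 8 _·_)
  open CommutativeSemigroupProperties *-commutativeSemigroup using (x∙yz≈y∙xz)
  open CommutativeSemigroupProperties +-commutativeSemigroup using (interchange)
  open RingProperties ring using (-‿distribʳ-*; -‿+-comm; -0#≈0#)
  open SetoidReasoning setoid

  eval-const : ∀ a → eval (const a) x ≈ a
  eval-const a = trans (+-congˡ (zeroʳ x)) (+-identityʳ a)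

  eval-X : eval X x ≈ x
  eval-X = begin
    0# + x * eval (const 1#) x  ≈⟨ +-identityˡ _ ⟩
    x * eval (const 1#) x       ≈⟨ *-congˡ (eval-const 1#) ⟩
    x * 1#                      ≈⟨ *-identityʳ x ⟩
    x                           ∎

  eval-+ : ∀ f g → eval (f +ₚ g) x ≈ eval f x + eval g x
  eval-+ []      g       = sym (+-identityˡ _)
  eval-+ (a ∷ f) []      = sym (+-identityʳ _)
  eval-+ (a ∷ f) (b ∷ g) = begin
    a + b + x * eval (f +ₚ g) x           ≈⟨ +-congˡ (*-congˡ (eval-+ f g)) ⟩
    a + b + x * (eval f x + eval g x)     ≈⟨ +-congˡ (distribˡ _ _ _) ⟩
    a + b + (x * eval f x + x * eval g x) ≈⟨ interchange _ _ _ _ ⟩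
    a + x * eval f x + (b + x * eval g x) ∎

  eval-map-* : ∀ a f → eval (map (a *_) f) x ≈ a * eval f x
  eval-map-* a []      = sym (zeroʳ a)
  eval-map-* a (b ∷ f) = begin
    a * b + x * eval (map (a *_) f) x  ≈⟨ +-congˡ (*-congˡ (eval-map-* a f)) ⟩
    a * b + x * (a * eval f x)         ≈⟨ +-congˡ (x∙yz≈y∙xz _ _ _) ⟩
    a * b + a * (x * eval f x)         ≈⟨ distribˡ _ _ _ ⟨
    a * (b + x * eval f x)             ∎

  eval-* : ∀ f g → eval (f *ₚ g) x ≈ eval f x * eval g x
  eval-* []      g = sym (zeroˡ _)
  eval-* (a ∷ f) g = begin
    eval (map (a *_) g +ₚ (0# ∷ f *ₚ g)) x             ≈⟨ eval-+ (map (a *_) g) _ ⟩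
    eval (map (a *_) g) x + (0# + x * eval (f *ₚ g) x) ≈⟨ +-cong (eval-map-* a g) (+-identityˡ _) ⟩
    a * eval g x + x * eval (f *ₚ g) x                 ≈⟨ +-congˡ (*-congˡ (eval-* f g)) ⟩
    a * eval g x + x * (eval f x * eval g x)           ≈⟨ +-congˡ (*-assoc _ _ _) ⟨
    a * eval g x + x * eval f x * eval g x             ≈⟨ distribʳ _ _ _ ⟨
    (a + x * eval f x) * eval g x                      ∎

  eval-neg : ∀ f → eval (map (λ a → - a) f) x ≈ - eval f x
  eval-neg []      = sym -0#≈0#
  eval-neg (a ∷ f) = begin
    - a + x * eval (map (λ a → - a) f) x  ≈⟨ +-congˡ (*-congˡ (eval-neg f)) ⟩
    - a + x * - eval f x                  ≈⟨ +-congˡ (-‿distribʳ-* _ _) ⟨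
    - a - x * eval f x                    ≈⟨ -‿+-comm _ _ ⟩
    - (a + x * eval f x)                  ∎

  eval-sum : ∀ {n} (fs : Fin n → Poly) → eval (sumₚ fs) x ≈ sum (λ i → eval (fs i) x)
  eval-sum {zero}  fs = refl
  eval-sum {suc n} fs = trans (eval-+ (fs zero) _) (+-congˡ (eval-sum (λ i → fs (suc i))))

  eval-· : ∀ n f → eval (n ·ₚ f) x ≈ n · eval f x
  eval-· zero    f = refl
  eval-· (suc n) f = trans (eval-+ f _) (+-congˡ (eval-· n f))

  eval-·1 : ∀ n → eval (n ·ₚ const 1#) x ≈ n · 1#
  eval-·1 n = trans (eval-· n _) (Mult.×-congʳ semiring n (eval-const 1#))

  eval-^ : ∀ f n → eval (f ^ₚ n) x ≈ eval f x ^ n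
  eval-^ f zero    = eval-const 1#
  eval-^ f (suc n) = trans (eval-* f _) (*-congˡ (eval-^ f n))

-- The generating function of the Euler polynomials over `K`.

module EulerProperties {c ℓ₁ ℓ₂} (K : HeytingField c ℓ₁ ℓ₂)
                       (fromℚ : ℚ → HeytingField.Carrier K)
                       (d : ℕ) (χ : ℤ → HeytingField.Carrier K) where
  open CommutativeRing (fieldCommutativeRing K) hiding (zero)
  open Polynomials K using (eval; const; X; _+ₚ_; _*ₚ_; polyRawRing)
  open GeneralizedEuler K fromℚ d χ using (E; generatingFunction; characterSum)
  open EulerSum K fromℚ d χ using (sumOverTriples; eulerSum)
  open PowerSeries (fieldRawRing K) fromℚ
  open PowerSeriesProperties (fieldCommutativeRing K) fromℚ
  open Mult semiring renaming (_×_ to infixr 8 _·_)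
  open Exp commutativeSemiring using (_^_; ^-congˡ)
  open Sum semiring using (sum; sum-cong-≋; *-distribˡ-sum)
  open RawRing polyRawRing using () renaming (-_ to infix 8 -ₚ_; 1# to 1ₚ)
  open RawSemiringDefs (RawRing.rawSemiring polyRawRing) using ()
    renaming (_×_ to infixr 8 _·ₚ_; _^_ to infixr 8 _^ₚ_)
  private
    module Poly = PowerSeries polyRawRing (λ r → const (fromℚ r))
    module ⊛ = CommutativeSemigroupProperties ⊛-commutativeSemigroup

  denominator : Series
  denominator = exp (d · 1#) ⊕ one

  characterSumK : Series
  characterSumK n = sum {d} λ i →
    (((- 1#) ^ toℕ i * χ (+ toℕ i)) • exp (toℕ i · 1#)) n

  -- G(t) = 2 / (e^(dt) + 1) · Σ_{a < d} (-1)^a χ(a) e^(at); below, G a is G(at).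
  eulerFactor : Series
  eulerFactor = ((2 · 1#) • quotient (fromℚ ½) one denominator) ⊛ characterSumK

  G : ℕ → Series
  G a = scale a eulerFactor

  module _ (x : Carrier) where
    open Evaluation K x
    open SetoidReasoning setoid

    evalSeries : Poly.Series → Series
    evalSeries f n = eval (f n) x

    evalSeries-⊛ : ∀ f g → evalSeries (f Poly.⊛ g) ≋ evalSeries f ⊛ evalSeries g
    evalSeries-⊛ f g n = trans
      (eval-sum {suc n} (λ i → f (toℕ i) *ₚ g (n ∸ toℕ i)))
      (sum-cong-≋ {suc n} λ i → eval-* (f (toℕ i)) (g (n ∸ toℕ i)))

    evalSeries-exp : ∀ f → evalSeries (Poly.exp f) ≋ exp (eval f x)
    evalSeries-exp f n = trans (eval-* (const (fromℚ (1/ n !))) (f ^ₚ n))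
      (*-cong (eval-const _) (eval-^ f n))

    evalSeries-one : evalSeries Poly.one ≋ one
    evalSeries-one zero    = eval-const 1#
    evalSeries-one (suc n) = refl

    -- Long division uses only ring operations on coefficients, so evaluation passes through each
    -- step; the induction lets the dividend vary.
    evalSeries-quotient : ∀ u f g →
      evalSeries (Poly.quotient u f g) ≋ quotient (eval u x) (evalSeries f) (evalSeries g)
    evalSeries-quotient u f g zero    = eval-* (f 0) u
    evalSeries-quotient u f g (suc n) = trans
      (evalSeries-quotient u (λ k → f (suc k) +ₚ -ₚ (f 0 *ₚ u *ₚ g (suc k))) g n)
      (quotient-congˡ (λ k → trans (eval-+ (f (suc k)) _) (+-congˡ (trans
        (eval-neg (f 0 *ₚ u *ₚ g (suc k)))
        (-‿cong (trans (eval-* (f 0 *ₚ u) (g (suc k))) (*-congʳ (eval-* (f 0) u))))))) n)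

    -- Every coefficient of `characterSum` is built from constant polynomials, so `x` disappears.
    evalSeries-characterSum : evalSeries characterSum ≋ characterSumK
    evalSeries-characterSum n = trans (eval-sum {d} _) (sum-cong-≋ {d} term)
      where
      term : ∀ i → let a = toℕ i in
        eval (((((-ₚ 1ₚ) ^ₚ a) *ₚ const (χ (+ a))) Poly.• Poly.exp (a ·ₚ 1ₚ)) n) x ≈
        (((- 1#) ^ a * χ (+ a)) • exp (a · 1#)) n
      term i = let a = toℕ i in
        trans (eval-* (((-ₚ 1ₚ) ^ₚ a) *ₚ const (χ (+ a))) (Poly.exp (a ·ₚ 1ₚ) n)) (*-cong
          (trans (eval-* ((-ₚ 1ₚ) ^ₚ a) _) (*-cong
            -- The polynomial `-ₚ 1ₚ` reduces to `const (- 1#)`.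
            (trans (eval-^ (-ₚ 1ₚ) a) (^-congˡ a (eval-const (- 1#))))
            (eval-const (χ (+ a)))))
          (trans (evalSeries-exp (a ·ₚ 1ₚ) n) (exp-cong (eval-·1 a) n)))

    -- The point `x` enters only through the numerator 2e^(xt), and division by a fixed series is
    -- multiplication by a fixed series, so e^(xt) factors out.
    evalSeries-generatingFunction : evalSeries generatingFunction ≋ exp x ⊛ eulerFactor
    evalSeries-generatingFunction n = begin
      evalSeries generatingFunction n
        ≈⟨ evalSeries-⊛ factor characterSum n ⟩
      (evalSeries factor ⊛ evalSeries characterSum) n
        ≈⟨ ⊛-cong evalSeries-factor evalSeries-characterSum n ⟩
      ((exp x ⊛ ((2 · 1#) • Q)) ⊛ characterSumK) n
        ≈⟨ ⊛-assoc (exp x) ((2 · 1#) • Q) characterSumK n ⟩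
      (exp x ⊛ eulerFactor) n ∎
      where
      Q : Series
      Q = quotient (fromℚ ½) one denominator
      numeratorₚ denominatorₚ factor : Poly.Series
      numeratorₚ   = (2 ·ₚ 1ₚ) Poly.• Poly.exp X
      denominatorₚ = Poly.exp (d ·ₚ 1ₚ) Poly.⊕ Poly.one
      factor       = Poly.quotient (const (fromℚ ½)) numeratorₚ denominatorₚ
      evalSeries-factor : evalSeries factor ≋ exp x ⊛ ((2 · 1#) • Q)
      evalSeries-factor k = begin
        evalSeries factor k
          ≈⟨ evalSeries-quotient (const (fromℚ ½)) numeratorₚ denominatorₚ k ⟩
        quotient (eval (const (fromℚ ½)) x) (evalSeries numeratorₚ) (evalSeries denominatorₚ) k
          ≈⟨ quotient-cong (eval-const _)
               (λ m → trans (eval-* (2 ·ₚ 1ₚ) (Poly.exp X m))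
                        (*-cong (eval-·1 2) (trans (evalSeries-exp X m) (exp-cong eval-X m))))
               (λ m → trans (eval-+ (Poly.exp (d ·ₚ 1ₚ) m) (Poly.one m))
                        (+-cong (trans (evalSeries-exp (d ·ₚ 1ₚ) m) (exp-cong (eval-·1 d) m))
                                (evalSeries-one m))) k ⟩
        quotient (fromℚ ½) ((2 · 1#) • exp x) denominator k
          ≈⟨ quotient-• (fromℚ ½) (2 · 1#) (exp x) denominator k ⟩
        (2 · 1#) * quotient (fromℚ ½) (exp x) denominator k
          ≈⟨ *-congˡ (quotient≋⊛ (fromℚ ½) (exp x) denominator k) ⟩
        -- `•-⊛-assoc` attaches a scalar to the left factor, so `Q` is moved to the left for that
        -- step and back afterwards.
        (2 · 1#) * (exp x ⊛ Q) k
          ≈⟨ *-congˡ (⊛-comm (exp x) Q k) ⟩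
        (2 · 1#) * (Q ⊛ exp x) k
          ≈⟨ •-⊛-assoc (2 · 1#) Q (exp x) k ⟨
        (((2 · 1#) • Q) ⊛ exp x) k
          ≈⟨ ⊛-comm ((2 · 1#) • Q) (exp x) k ⟩
        (exp x ⊛ ((2 · 1#) • Q)) k ∎

    eval-E : ∀ n → eval (E n) x ≈ (n !) · (exp x ⊛ eulerFactor) n
    eval-E n = trans (eval-· (n !) _) (×-congʳ (n !) (evalSeries-generatingFunction n))

  -- Triple sums as coefficients of triple products, and their symmetry.

  open SetoidReasoning setoid

  -- The inner sum over j is the coefficient of `g ⊛ h` at n - i, so the nested sum is a coefficient
  -- of the triple product. The termwise hypothesis is restricted to k + l + m = n because only
  -- there does the multinomial numerator equal `n !`, the common factor `s` in the application.
  sumOverTriples-⊛ : ∀ n {T : ℕ → ℕ → ℕ → Carrier} (s : ℕ) f g h →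
    (∀ k l m → k ℕ.+ l ℕ.+ m ≡ n → T k l m ≈ s · (f k * (g l * h m))) →
    sumOverTriples n T ≈ s · (f ⊛ (g ⊛ h)) n
  sumOverTriples-⊛ n {T} s f g h T≈ = begin
    sumOverTriples n T
      ≈⟨ (sum-cong-≋ {suc n} λ i → sum-cong-≋ {suc (n ∸ toℕ i)} λ j →
           T≈ (toℕ i) (toℕ j) (n ∸ toℕ i ∸ toℕ j) (i+j+[n∸i∸j]≡n (toℕ≤pred[n] i) (toℕ≤pred[n] j))) ⟩
    (sum {suc n} λ i → sum {suc (n ∸ toℕ i)} λ j →
      s · (f (toℕ i) * (g (toℕ j) * h (n ∸ toℕ i ∸ toℕ j))))
      -- Under `sym`: `f (toℕ i)` and then `s` are distributed into the inner sum, so the step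
      -- itself collects them in front of it.
      ≈⟨ (sum-cong-≋ {suc n} λ i → sym (trans
           (×-congʳ s (*-distribˡ-sum {suc (n ∸ toℕ i)} (f (toℕ i))
             (λ j → g (toℕ j) * h (n ∸ toℕ i ∸ toℕ j))))
           (·-distrib-sum s {suc (n ∸ toℕ i)} λ j →
             f (toℕ i) * (g (toℕ j) * h (n ∸ toℕ i ∸ toℕ j))))) ⟩
    (sum {suc n} λ i → s · (f (toℕ i) * (g ⊛ h) (n ∸ toℕ i)))
      ≈⟨ ·-distrib-sum s {suc n} (λ i → f (toℕ i) * (g ⊛ h) (n ∸ toℕ i)) ⟨
    s · (f ⊛ (g ⊛ h)) n ∎

  module _ (y₁ y₂ y₃ : Carrier) where

    -- This is used at a = uvw. It depends on u, v, w only through that product, so the three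
    -- exponentials can stay separate.
    exponentials : ℕ → Series
    exponentials a = exp (a · y₁) ⊛ (exp (a · y₂) ⊛ exp (a · y₃))

    eulerFactors : ℕ → ℕ → ℕ → Series
    eulerFactors u v w =
      G (v ℕ.* w) ⊛ (G (u ℕ.* w) ⊛ G (u ℕ.* v))

    -- The exponent `c` is tied to `a` and `b` by an equation, so that vw times u, uw times v and uv
    -- times w can all be given the same form `u * v * w`.
    scale-exp-⊛ : ∀ a {b c} → a ℕ.* b ≡ c → ∀ y →
      scale a (exp (b · y) ⊛ eulerFactor) ≋ exp (c · y) ⊛ G a
    scale-exp-⊛ a {b} ≡.refl y n = trans (scale-⊛ a (exp (b · y)) eulerFactor n)
      (⊛-congʳ (G a) (λ k → trans (scale-exp a (b · y) k) (exp-cong (×-assocˡ y a b) k)) n)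

    eulerSum-⊛ : ∀ n u v w → eulerSum n u v w y₁ y₂ y₃ ≈
      (n !) · (exponentials (u ℕ.* v ℕ.* w) ⊛ eulerFactors u v w) n
    eulerSum-⊛ n u v w = trans
      (sumOverTriples-⊛ n (n !)
        (scale (v ℕ.* w) (F u y₁)) (scale (u ℕ.* w) (F v y₂)) (scale (u ℕ.* v) (F w y₃)) term)
      (×-congʳ (n !) (begin
        (scale (v ℕ.* w) (F u y₁) ⊛ (scale (u ℕ.* w) (F v y₂) ⊛ scale (u ℕ.* v) (F w y₃))) n
          ≈⟨ ⊛-cong (scale-exp-⊛ (v ℕ.* w) vwu y₁)
               (⊛-cong (scale-exp-⊛ (u ℕ.* w) uwv y₂) (scale-exp-⊛ (u ℕ.* v) ≡.refl y₃)) n ⟩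
        ((e y₁ ⊛ G (v ℕ.* w)) ⊛ ((e y₂ ⊛ G (u ℕ.* w)) ⊛ (e y₃ ⊛ G (u ℕ.* v)))) n
          -- Two interchanges separate exponentials from Euler factors, first within the last two
          -- brackets and then across the whole product.
          ≈⟨ ⊛-congˡ (e y₁ ⊛ G (v ℕ.* w))
               (⊛.interchange (e y₂) (G (u ℕ.* w)) (e y₃) (G (u ℕ.* v))) n ⟩
        ((e y₁ ⊛ G (v ℕ.* w)) ⊛ ((e y₂ ⊛ e y₃) ⊛ (G (u ℕ.* w) ⊛ G (u ℕ.* v)))) n
          ≈⟨ ⊛.interchange (e y₁) (G (v ℕ.* w)) (e y₂ ⊛ e y₃) (G (u ℕ.* w) ⊛ G (u ℕ.* v)) n ⟩
        (exponentials (u ℕ.* v ℕ.* w) ⊛ eulerFactors u v w) n ∎))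
      where
      F : ℕ → Carrier → Series
      F a y = exp (a · y) ⊛ eulerFactor
      e : Carrier → Series
      e y = exp ((u ℕ.* v ℕ.* w) · y)
      vwu : v ℕ.* w ℕ.* u ≡ u ℕ.* v ℕ.* w
      vwu = ≡.trans (ℕ.*-comm (v ℕ.* w) u) (≡.sym (ℕ.*-assoc u v w))
      uwv : u ℕ.* w ℕ.* v ≡ u ℕ.* v ℕ.* w
      uwv = ≡.trans (ℕ.*-assoc u w v) (≡.trans (≡.cong (u ℕ.*_) (ℕ.*-comm w v))
              (≡.sym (ℕ.*-assoc u v w)))
      term : ∀ k l m → k ℕ.+ l ℕ.+ m ≡ n →
        (multinomial k l m ℕ.* u ℕ.^ (l ℕ.+ m) ℕ.* v ℕ.^ (k ℕ.+ m) ℕ.* w ℕ.^ (k ℕ.+ l)) ·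
          (eval (E k) (u · y₁) * eval (E l) (v · y₂) * eval (E m) (w · y₃)) ≈
        (n !) · (scale (v ℕ.* w) (F u y₁) k *
          (scale (u ℕ.* w) (F v y₂) l * scale (u ℕ.* v) (F w y₃) m))
      -- Matching on `≡.refl` replaces `n` by `k + l + m`, so `n !` is the factorial supplied by
      -- `multinomial-weight`.
      term k l m ≡.refl = begin
        N · (eval (E k) (u · y₁) * eval (E l) (v · y₂) * eval (E m) (w · y₃))
          ≈⟨ ×-congʳ N (*-cong (*-cong (eval-E (u · y₁) k) (eval-E (v · y₂) l)) (eval-E (w · y₃) m)) ⟩
        N · ((k !) · F u y₁ k * (l !) · F v y₂ l * (m !) · F w y₃ m)
          ≈⟨ ×-congʳ N (trans (*-congʳ (·-*-· (k !) (l !) _ _)) (·-*-· (k ! ℕ.* l !) (m !) _ _)) ⟩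
        N · ((k ! ℕ.* l ! ℕ.* m !) · (F u y₁ k * F v y₂ l * F w y₃ m))
          ≈⟨ ×-assocˡ _ N _ ⟩
        (N ℕ.* (k ! ℕ.* l ! ℕ.* m !)) · (F u y₁ k * F v y₂ l * F w y₃ m)
          -- The weight `N` and the factorials from `eval-E` are exchanged here for `n !` and the
          -- weights of the three `scale` operations.
          ≈⟨ ×-cong (multinomial-weight u v w k l m) (*-assoc _ _ _) ⟩
        (n ! ℕ.* (q ℕ.* (r ℕ.* s))) · (F u y₁ k * (F v y₂ l * F w y₃ m))
          ≈⟨ ×-assocˡ _ (n !) _ ⟨
        (n !) · (q ℕ.* (r ℕ.* s)) · (F u y₁ k * (F v y₂ l * F w y₃ m))
          ≈⟨ ×-congʳ (n !) (trans (*-congˡ (·-*-· r s _ _)) (·-*-· q (r ℕ.* s) _ _)) ⟨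
        (n !) · (q · F u y₁ k * (r · F v y₂ l * s · F w y₃ m)) ∎
        where
        N = multinomial k l m ℕ.* u ℕ.^ (l ℕ.+ m) ℕ.* v ℕ.^ (k ℕ.+ m) ℕ.* w ℕ.^ (k ℕ.+ l)
        q = (v ℕ.* w) ℕ.^ k
        r = (u ℕ.* w) ℕ.^ l
        s = (u ℕ.* v) ℕ.^ m

    -- Exchanging u and v exchanges the arguments vw and uw of the first two Euler factors and fixes
    -- uv and uvw up to commutativity. Together with the exchange of the last two parameters this
    -- generates all six orders.
    eulerSum-swap₁₂ : ∀ n u v w → eulerSum n u v w y₁ y₂ y₃ ≈ eulerSum n v u w y₁ y₂ y₃
    eulerSum-swap₁₂ n u v w = begin
      eulerSum n u v w y₁ y₂ y₃
        ≈⟨ eulerSum-⊛ n u v w ⟩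
      (n !) · (exponentials (u ℕ.* v ℕ.* w) ⊛ eulerFactors u v w) n
        ≈⟨ ×-congʳ (n !) (⊛-congˡ (exponentials (u ℕ.* v ℕ.* w))
             (⊛.x∙yz≈y∙xz (G (v ℕ.* w)) (G (u ℕ.* w)) (G (u ℕ.* v))) n) ⟩
      (n !) · (exponentials (u ℕ.* v ℕ.* w) ⊛ (G (u ℕ.* w) ⊛
        (G (v ℕ.* w) ⊛ G (u ℕ.* v)))) n
        -- Since `u * v * w` associates to the left, one rewrite of `u * v` changes both the
        -- exponent and the argument of the last factor.
        ≡⟨ ≡.cong (λ a → (n !) · (exponentials (a ℕ.* w) ⊛ (G (u ℕ.* w) ⊛
             (G (v ℕ.* w) ⊛ G a))) n) (ℕ.*-comm u v) ⟩
      (n !) · (exponentials (v ℕ.* u ℕ.* w) ⊛ eulerFactors v u w) n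
        ≈⟨ eulerSum-⊛ n v u w ⟨
      eulerSum n v u w y₁ y₂ y₃ ∎

    eulerSum-swap₂₃ : ∀ n u v w → eulerSum n u v w y₁ y₂ y₃ ≈ eulerSum n u w v y₁ y₂ y₃
    eulerSum-swap₂₃ n u v w = begin
      eulerSum n u v w y₁ y₂ y₃
        ≈⟨ eulerSum-⊛ n u v w ⟩
      (n !) · (exponentials (u ℕ.* v ℕ.* w) ⊛ eulerFactors u v w) n
        ≈⟨ ×-congʳ (n !) (⊛-congˡ (exponentials (u ℕ.* v ℕ.* w))
             (⊛.x∙yz≈x∙zy (G (v ℕ.* w)) (G (u ℕ.* w)) (G (u ℕ.* v))) n) ⟩
      (n !) · (exponentials (u ℕ.* v ℕ.* w) ⊛ (G (v ℕ.* w) ⊛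
        (G (u ℕ.* v) ⊛ G (u ℕ.* w)))) n
        -- Here `v * w` is not a subterm of `u * v * w`, so the exponent and the argument of the
        -- first factor are rewritten separately.
        ≡⟨ ≡.cong₂ (λ a b → (n !) · (exponentials a ⊛ (G b ⊛
             (G (u ℕ.* v) ⊛ G (u ℕ.* w)))) n)
             (≡.trans (ℕ.*-assoc u v w) (≡.trans (≡.cong (u ℕ.*_) (ℕ.*-comm v w))
               (≡.sym (ℕ.*-assoc u w v))))
             (ℕ.*-comm v w) ⟩
      (n !) · (exponentials (u ℕ.* w ℕ.* v) ⊛ eulerFactors u w v) n
        ≈⟨ eulerSum-⊛ n u w v ⟨
      eulerSum n u w v y₁ y₂ y₃ ∎

theorem4p1 :
  ∀ {c ℓ₁ ℓ₂}
    (p : ℕ) → Prime p → ¬ (2 ∣ p) →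
    (𝔽 : PadicFields p c ℓ₁ ℓ₂) → let open PadicFields 𝔽 in
    (ℚᵃ : AlgebraicClosure heytingField c ℓ₁ ℓ₂) → let open AlgebraicClosure ℚᵃ in
    (σ : ⌞ closure ⌟ → ⌞ ℂₚ ⌟) → IsFieldHomomorphism closure ℂₚ σ →
    (d : ℕ) → ¬ (2 ∣ d) →
    (ψ : DirichletCharacter closure d) → DirichletCharacter.IsPrimitive ψ →
    let open HeytingField ℂₚ using (_≈_)
        open EulerSum ℂₚ ℚ→ℂₚ d (λ a → σ (DirichletCharacter.χ ψ a)) using (eulerSum)
    in
    (w₁ w₂ w₃ : ℕ) → .{{NonZero w₁}} → .{{NonZero w₂}} → .{{NonZero w₃}} →
    (n : ℕ) (y₁ y₂ y₃ : ℤₚ) →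
    let S = λ u v w → eulerSum n u v w (ℤₚ→ℂₚ y₁) (ℤₚ→ℂₚ y₂) (ℤₚ→ℂₚ y₃) in
      (S w₁ w₂ w₃ ≈ S w₁ w₃ w₂)
    × (S w₁ w₃ w₂ ≈ S w₂ w₁ w₃)
    × (S w₂ w₁ w₃ ≈ S w₂ w₃ w₁)
    × (S w₂ w₃ w₁ ≈ S w₃ w₁ w₂)
    × (S w₃ w₁ w₂ ≈ S w₃ w₂ w₁)
theorem4p1 p _ _ 𝔽 ℚᵃ σ _ d _ ψ _ w₁ w₂ w₃ n y₁ y₂ y₃ =
    swap₂₃ w₁ w₂ w₃
  -- The second and fourth links are 3-cycles of the parameters, hence two transpositions each,
  -- passing through `S w₁ w₂ w₃` and `S w₃ w₂ w₁` respectively.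
  , trans (swap₂₃ w₁ w₃ w₂) (swap₁₂ w₁ w₂ w₃)
  , swap₂₃ w₂ w₁ w₃
  , trans (swap₁₂ w₂ w₃ w₁) (swap₂₃ w₃ w₂ w₁)
  , swap₂₃ w₃ w₁ w₂
  where
  open PadicFields 𝔽
  open HeytingField ℂₚ using (trans)
  open EulerProperties ℂₚ ℚ→ℂₚ d (λ a → σ (DirichletCharacter.χ ψ a))
  swap₁₂ = eulerSum-swap₁₂ (ℤₚ→ℂₚ y₁) (ℤₚ→ℂₚ y₂) (ℤₚ→ℂₚ y₃) n
  swap₂₃ = eulerSum-swap₂₃ (ℤₚ→ℂₚ y₁) (ℤₚ→ℂₚ y₂) (ℤₚ→ℂₚ y₃) n
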